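{- Let $p$ be a prime, $q=p^\lambda$ with $\lambda\ge1$, and let $F$ be a field with $\mathbb F_q\subseteq F$. Let $W=\{w_t(x)\}_{t=0}^\infty$ and $V=\{v_t(x)\}_{t=0}^\infty$ be two sequences of $\mathbb F_q$-linear polynomials in $F[x]$, with termwise sum $W+V=\{w_t(x)+v_t(x)\}_{t=0}^\infty$. Then in $F[x]\{\{\mathfrak D\}\}$ one has $$f_{P_W}(x)\cdot f_{P_V}(x)=f_{P_{(W+V)}}(x).$$
   Context: A polynomial in $F[x]$ is $\mathbb F_q$-linear if it is a finite $F$-linear combination of monomials $x^{q^n}$, $n\ge0$. For a sequence $E=\{e_t(x)\}_{t=0}^\infty$ of $\mathbb F_q$-linear polynomials and an integer $i\ge0$ with $q$-adic expansion $i=\sum_t i_tq^t$ ($0\le i_t<q$), put $p_{E,i}(x):=\prod_t e_t(x)^{i_t}$ (with $e^0=1$), $P_E:=\{p_{E,i}(x)\}_{i=0}^\infty$, and $f_{P_E}(x):=\sum_{i\ge0}p_{E,i}(x)\mathfrak D_i\in F[x]\{\{\mathfrak D\}\}$. $F[x]\{\{\mathfrak D\}\}$ is the commutative ring of formal series $\sum_{i\ge0}a_i\mathfrak D_i$ ($a_i\in F[x]$) with coefficientwise addition and multiplication $(\sum_i a_i\mathfrak D_i)(\sum_j b_j\mathfrak D_j)=\sum_n\big(\sum_{i=0}^n\binom ni a_ib_{n-i}\big)\mathfrak D_n$. -}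

module Defs where

open import Algebra.Apartness.Bundles using (HeytingField; HeytingCommutativeRing)
open import Algebra.Bundles using (CommutativeRing)
open import Algebra.Bundles.Raw using (RawRing)
open import Algebra.Morphism.Structures using (IsRingMonomorphism)
import Algebra.Definitions.RawSemiring as RawSemiringDefinitions
open import Data.Fin.Base using (Fin; toℕ)
open import Data.List.Base using (List; []; _∷_; map)
open import Data.Nat.Base as ℕ using (ℕ; zero; suc; NonZero; _∸_; _/_; _%_)
open import Data.Nat.Combinatorics using (_C_)
open import Data.Nat.Properties using (m^n≢0)
open import Data.Product.Base using (∃-syntax; Σ-syntax)
open import Data.Vec.Functional using (Vector)
open import Function.Bundles using (Inverse)
open import Level using (Level; _⊔_) renaming (suc to lsuc)
open import Relation.Binary.PropositionalEquality using (setoid)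

private
  variable
    c ℓ : Level

module _ {c ℓ₁ ℓ₂} (F : HeytingField c ℓ₁ ℓ₂) where
  fieldCommutativeRing : CommutativeRing c ℓ₁
  fieldCommutativeRing =
    HeytingCommutativeRing.commutativeRing (HeytingField.heytingCommutativeRing F)

  fieldRawRing : RawRing c ℓ₁
  fieldRawRing = CommutativeRing.rawRing fieldCommutativeRing

-- 𝔽_q ⊆ F, presented as a field with exactly q elements together with an
-- injective ring homomorphism into F.
record FiniteSubfield {c ℓ₁ ℓ₂} (q : ℕ) (F : HeytingField c ℓ₁ ℓ₂) k κ₁ κ₂ :
                      Set (c ⊔ ℓ₁ ⊔ lsuc (k ⊔ κ₁ ⊔ κ₂)) where
  field
    𝔽q       : HeytingField k κ₁ κ₂
    elements : Inverse (setoid (Fin q)) (CommutativeRing.setoid (fieldCommutativeRing 𝔽q))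
    embed    : HeytingField.Carrier 𝔽q → HeytingField.Carrier F
    embed-isRingMonomorphism :
      IsRingMonomorphism (fieldRawRing 𝔽q) (fieldRawRing F) embed

-- Polynomials in one variable are coefficient lists, constant term first.
-- Trailing zeros are allowed, so equality compares all coefficients.
module Polynomial (R : RawRing c ℓ) where
  open RawRing R

  Poly : Set c
  Poly = List Carrier

  coeff : Poly → ℕ → Carrier
  coeff []      _       = 0#
  coeff (a ∷ f) zero    = a
  coeff (a ∷ f) (suc n) = coeff f n

  infix  4 _≈ₚ_
  infixl 6 _+ₚ_
  infixl 7 _*ₚ_

  _≈ₚ_ : Poly → Poly → Set ℓ
  f ≈ₚ g = ∀ n → coeff f n ≈ coeff g n

  _+ₚ_ : Poly → Poly → Poly
  []      +ₚ g       = g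
  (a ∷ f) +ₚ []      = a ∷ f
  (a ∷ f) +ₚ (b ∷ g) = (a + b) ∷ (f +ₚ g)

  -- (a + x f) g = a g + x (f g)
  _*ₚ_ : Poly → Poly → Poly
  []      *ₚ g = []
  (a ∷ f) *ₚ g = map (a *_) g +ₚ (0# ∷ (f *ₚ g))

  const : Carrier → Poly
  const a = a ∷ []

  X : Poly
  X = 0# ∷ 1# ∷ []

  polyRing : RawRing c ℓ
  polyRing = record
    { Carrier = Poly
    ; _≈_     = _≈ₚ_
    ; _+_     = _+ₚ_
    ; _*_     = _*ₚ_
    ; -_      = map (-_)
    ; 0#      = []
    ; 1#      = const 1#
    }

-- The ring R{{𝔇}}: the series ∑ aᵢ 𝔇ᵢ is represented by i ↦ aᵢ.
module DividedSeries (R : RawRing c ℓ) where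
  open RawRing R
  open RawSemiringDefinitions rawSemiring using (sum; _×_)

  Series : Set c
  Series = ℕ → Carrier

  seriesRing : RawRing c ℓ
  seriesRing = record
    { Carrier = Series
    ; _≈_     = λ a b → ∀ n → a n ≈ b n
    ; _+_     = λ a b n → a n + b n
    ; _*_     = λ a b n → sum {suc n} λ i →
                  (n C toℕ i) × (a (toℕ i) * b (n ∸ toℕ i))
    ; -_      = λ a n → - a n
    ; 0#      = λ _ → 0#
    ; 1#      = λ { zero → 1# ; (suc _) → 0# }
    }

digit : (q : ℕ) .{{_ : NonZero q}} → ℕ → ℕ → ℕ
digit q i t = (_/_ i (q ℕ.^ t) {{m^n≢0 q t}}) % q

module LinearPolynomials {c ℓ₁ ℓ₂} (q : ℕ) .{{_ : NonZero q}}
                         (F : HeytingField c ℓ₁ ℓ₂) where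
  open HeytingField F using (Carrier)
  open Polynomial (fieldRawRing F) public
  open RawRing polyRing using (_*_; rawSemiring)
  open RawSemiringDefinitions rawSemiring using (sum; product; _^_)
  open DividedSeries polyRing public

  IsFqLinear : Poly → Set (c ⊔ ℓ₁)
  IsFqLinear f =
    ∃[ m ] Σ[ a ∈ Vector Carrier m ]
      f ≈ₚ sum (λ n → const (a n) * X ^ (q ℕ.^ toℕ n))

  -- ∏ₜ eₜ^{iₜ}. For q ≥ 2 and t ≥ i one has q^t > i, so iₜ = 0 and the
  -- product may be cut off at t < i.
  monomial : (ℕ → Poly) → ℕ → Poly
  monomial e i = product {i} λ t → e (toℕ t) ^ digit q i (toℕ t)

  -- f_{P_E} = ∑ p_{E,i} 𝔇ᵢ
  f-P : (ℕ → Poly) → Series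
  f-P e = λ i → monomial e i

  infixl 6 _⊕_
  _⊕_ : (ℕ → Poly) → (ℕ → Poly) → (ℕ → Poly)
  (w ⊕ v) t = w t +ₚ v t

  open RawRing seriesRing public using ()
    renaming (_≈_ to infix 4 _≈ₛ_; _*_ to infixl 7 _*ₛ_)

{-# OPTIONS --safe #-}
-- The n-th coefficient of f_W · f_V is B n G = ∑ᵢ (n C i) G i (n ∸ i) with
-- G i j = p_{W,i} p_{V,j}. Pascal's rule says that B (suc n) G = B n (Δ G), where
-- Δ G i j = G (suc i) j + G i (suc j); hence B (m + n) splits into iterated sums.
-- In characteristic p one has B p G = G p 0 + G 0 p, so B (n q) is B n applied to
-- G sampled at multiples of q. As p_{E,r+mq} = e₀^r p_{E',m} for r < q, with E' the
-- sequence E shifted by one, B (r + m q) G is the binomial expansion of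
-- (w₀ + v₀)^r times the m-th coefficient for the shifted sequences, and strong
-- induction applies. In F one has p · 1 = 0, since (p · 1)^l = q · 1 = 0 by counting
-- the additive group of 𝔽_q.
module Submission where

open import Defs
open import Algebra.Apartness.Bundles using (HeytingField)
import Algebra.Apartness.Properties.HeytingCommutativeRing as HeytingProperties
open import Algebra.Bundles
  using (AbelianGroup; CommutativeMonoid; CommutativeRing; CommutativeSemiring)
import Algebra.Definitions.RawSemiring as RawSemiringDefinitions
open import Algebra.Morphism.Structures using (module IsRingMonomorphism)
import Algebra.Properties.CommutativeMonoid.Mult
import Algebra.Properties.CommutativeMonoid.Sum
import Algebra.Properties.CommutativeSemigroup
import Algebra.Properties.Group
import Algebra.Properties.Semiring.Binomial
import Algebra.Properties.Semiring.Exp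
import Algebra.Properties.Semiring.Mult
import Algebra.Properties.Semiring.Sum
open import Data.Fin.Base using (Fin; toℕ; fromℕ; inject₁)
open import Data.Fin.Permutation using (Permutation′; permutation; _⟨$⟩ʳ_)
open import Data.Fin.Properties using (toℕ<n; toℕ-fromℕ; toℕ-inject₁; toℕ≤pred[n])
open import Data.List.Base using ([]; _∷_; map)
open import Data.Nat.Base as ℕ
  using (ℕ; zero; suc; NonZero; _^_; _≥_; _≤_; _<_; z≤n; s≤s; _∸_; _/_; _%_)
open import Data.Nat.Combinatorics
  using (_C_; nC1≡n; nCn≡1; nCk+nC[k+1]≡[n+1]C[k+1]; k>n⇒nCk≡0)
open import Data.Nat.Divisibility using (_∣_; divides; m∣m*n; >⇒∤; n∣m*n)
open import Data.Nat.DivMod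
  using (m/n/o≡m/[n*o]; m<n⇒m/n≡0; m<n⇒m%n≡m; 0/n≡0; n/1≡n; m/n<m; [m+kn]%n≡m%n;
         +-distrib-/-∣ʳ; m*n/n≡m; m≡m%n+[m/n]*n; m%n<n)
open import Data.Nat.Induction using (<-rec)
open import Data.Nat.Primality using (Prime; euclidsLemma; prime⇒nonTrivial)
import Data.Nat.Properties as ℕ
open import Data.Product.Base using (_,_; proj₁)
open import Data.Sum.Base using (inj₁; inj₂)
open import Function.Base using (_∘_)
open import Function.Bundles using (Inverse)
open import Relation.Binary.Bundles using (Setoid)
open import Relation.Binary.PropositionalEquality as ≡ using (_≡_; cong; cong₂)
import Relation.Binary.Reasoning.Setoid as SetoidReasoning
open import Relation.Nullary.Negation using (contradiction)

-- Divisibility of binomial coefficients by a prime.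

-- The absorption identity, obtained from Pascal's rule by induction. With `suc n` a prime it shows
-- that this prime divides the product on the left.
[k+1]*[n+1]C[k+1]≡[n+1]*nCk : ∀ n k → suc k ℕ.* (suc n C suc k) ≡ suc n ℕ.* (n C k)
[k+1]*[n+1]C[k+1]≡[n+1]*nCk n zero = begin
  1 ℕ.* (suc n C 1) ≡⟨ ℕ.*-identityˡ _ ⟩
  suc n C 1         ≡⟨ nC1≡n (suc n) ⟩
  suc n             ≡⟨ ℕ.*-identityʳ _ ⟨
  suc n ℕ.* (n C 0) ∎
  where open ≡.≡-Reasoning
[k+1]*[n+1]C[k+1]≡[n+1]*nCk zero (suc k) = ℕ.*-zeroʳ (suc (suc k))
[k+1]*[n+1]C[k+1]≡[n+1]*nCk n@(suc n-1) k@(suc k-1) = begin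
  suc k ℕ.* (suc n C suc k)
    ≡⟨ cong (suc k ℕ.*_) (nCk+nC[k+1]≡[n+1]C[k+1] n k) ⟨
  suc k ℕ.* (n C k ℕ.+ n C suc k)
    ≡⟨ ℕ.*-distribˡ-+ (suc k) (n C k) _ ⟩
  n C k ℕ.+ k ℕ.* (n C k) ℕ.+ suc k ℕ.* (n C suc k)
    ≡⟨ cong₂ (λ x y → n C k ℕ.+ x ℕ.+ y) ([k+1]*[n+1]C[k+1]≡[n+1]*nCk n-1 k-1)
                                         ([k+1]*[n+1]C[k+1]≡[n+1]*nCk n-1 k) ⟩
  n C k ℕ.+ n ℕ.* (n-1 C k-1) ℕ.+ n ℕ.* (n-1 C k)
    ≡⟨ ℕ.+-assoc (n C k) _ _ ⟩
  n C k ℕ.+ (n ℕ.* (n-1 C k-1) ℕ.+ n ℕ.* (n-1 C k))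
    ≡⟨ cong (n C k ℕ.+_) (ℕ.*-distribˡ-+ n (n-1 C k-1) _) ⟨
  n C k ℕ.+ n ℕ.* (n-1 C k-1 ℕ.+ n-1 C k)
    ≡⟨ cong (λ x → n C k ℕ.+ n ℕ.* x) (nCk+nC[k+1]≡[n+1]C[k+1] n-1 k-1) ⟩
  suc n ℕ.* (n C k) ∎
  where open ≡.≡-Reasoning

-- By absorption `p` divides `k * (p C k)`, so Euclid's lemma leaves two cases, and `0 < k < p`
-- excludes `p ∣ k`.
p∣pCk : ∀ {p k} → Prime p → 0 < k → k < p → p ∣ p C k
p∣pCk {p@(suc p-1)} {k@(suc k-1)} p-prime _ k<p
  with euclidsLemma k (p C k) p-prime
         (≡.subst (p ∣_) (≡.sym ([k+1]*[n+1]C[k+1]≡[n+1]*nCk p-1 k-1)) (m∣m*n _))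
... | inj₁ p∣k   = contradiction p∣k (>⇒∤ k<p)
... | inj₂ p∣pCk = p∣pCk

n<m^n : ∀ {m} n → 1 < m → n < m ^ n
n<m^n         zero    1<m = ℕ.z<s
n<m^n {m} (suc n) 1<m = begin-strict
  suc n       ≤⟨ n<m^n n 1<m ⟩
  m ^ n       <⟨ ℕ.m<m*n (m ^ n) m {{ℕ.>-nonZero (ℕ.≤-<-trans z≤n (n<m^n n 1<m))}} 1<m ⟩
  m ^ n ℕ.* m ≡⟨ ℕ.*-comm (m ^ n) m ⟩
  m ^ suc n   ∎
  where open ℕ.≤-Reasoning

-- Binomial sums in a commutative monoid, in general and in characteristic p.

module _ {c ℓ} (M : CommutativeMonoid c ℓ) where
  open CommutativeMonoid M renaming (_∙_ to _+_; ε to 0#; ∙-cong to +-cong; ∙-congˡ to +-congˡ;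
    ∙-congʳ to +-congʳ; assoc to +-assoc; identityˡ to +-identityˡ; identityʳ to +-identityʳ; comm to +-comm)
  open Algebra.Properties.CommutativeMonoid.Mult M
  open Algebra.Properties.CommutativeMonoid.Sum M
  open Algebra.Properties.CommutativeSemigroup commutativeSemigroup using (x∙yz≈y∙xz)
  open SetoidReasoning setoid

  ×-zeroʳ : ∀ n → n × 0# ≈ 0#
  ×-zeroʳ zero    = refl
  ×-zeroʳ (suc n) = trans (+-identityˡ _) (×-zeroʳ n)

  sum-zero : ∀ {n} (t : Fin n → Carrier) → (∀ i → t i ≈ 0#) → sum t ≈ 0#
  sum-zero {n} t t≈0 = trans (sum-cong-≋ {n} t≈0) (sum-replicate-zero n)

  -- Used additively to drop a vanishing binomial term, and multiplicatively to shorten a product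
  -- whose last factors have exponent zero.
  sum-truncate : ∀ {m n} (f : ℕ → Carrier) → m ≤ n → (∀ t → m ≤ t → f t ≈ 0#) →
                 sum {n} (f ∘ toℕ) ≈ sum {m} (f ∘ toℕ)
  sum-truncate {n = n} f z≤n f≈0 = sum-zero {n} (f ∘ toℕ) λ i → f≈0 (toℕ i) z≤n
  sum-truncate f (s≤s m≤n) f≈0 =
    +-congˡ (sum-truncate (f ∘ suc) m≤n λ t m≤t → f≈0 (suc t) (s≤s m≤t))

  -- Opaque, so that G can be inferred from binomialSum n G.
  opaque
    binomialSum : ℕ → (ℕ → ℕ → Carrier) → Carrier
    binomialSum n G = sum {suc n} λ i → (n C toℕ i) × G (toℕ i) (n ∸ toℕ i)

  opaque
    unfolding binomialSum

    binomialSum-expand : ∀ n G →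
      binomialSum n G ≡ sum {suc n} λ i → (n C toℕ i) × G (toℕ i) (n ∸ toℕ i)
    binomialSum-expand n G = ≡.refl

    -- The bounds on `i` and `j` are made available because a digit can be split off from an index
    -- only while it stays below `q`.
    binomialSum-cong : ∀ n {G H} → (∀ i j → i ≤ n → j ≤ n → G i j ≈ H i j) →
                       binomialSum n G ≈ binomialSum n H
    binomialSum-cong n G≈H = sum-cong-≋ {suc n} λ i →
      ×-congʳ (n C toℕ i) (G≈H _ _ (toℕ≤pred[n] i) (ℕ.m∸n≤m n (toℕ i)))

    binomialSum-+ : ∀ n G H → binomialSum n (λ i j → G i j + H i j) ≈
                              binomialSum n G + binomialSum n H
    binomialSum-+ n G H = trans
      (sum-cong-≋ {suc n} λ i → ×-distrib-+ (G (toℕ i) (n ∸ toℕ i)) (H (toℕ i) (n ∸ toℕ i)) (n C toℕ i))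
      (∑-distrib-+ {suc n} (λ i → (n C toℕ i) × G (toℕ i) (n ∸ toℕ i))
                           (λ i → (n C toℕ i) × H (toℕ i) (n ∸ toℕ i)))

    binomialSum-zero : ∀ G → binomialSum 0 G ≈ G 0 0
    binomialSum-zero G = trans (+-identityʳ _) (+-identityʳ _)

    binomialSum-suc : ∀ n G → binomialSum (suc n) G ≈
                              binomialSum n (λ i j → G (suc i) j + G i (suc j))
    binomialSum-suc n G = begin
      binomialSum (suc n) G
        ≈⟨ +-congˡ (sum-cong-≋ {suc n} λ i → trans
             (×-congˡ (≡.sym (nCk+nC[k+1]≡[n+1]C[k+1] n (toℕ i))))
             (×-homo-+ (G (suc (toℕ i)) (n ∸ toℕ i)) (n C toℕ i) _)) ⟩
      f 0 + sum {suc n} (λ i → (n C toℕ i) × G (suc (toℕ i)) (n ∸ toℕ i) + f (suc (toℕ i)))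
        ≈⟨ +-congˡ (∑-distrib-+ {suc n} (λ i → (n C toℕ i) × G (suc (toℕ i)) (n ∸ toℕ i)) (f ∘ suc ∘ toℕ)) ⟩
      f 0 + (binomialSum n (λ i j → G (suc i) j) + sum {suc n} (f ∘ suc ∘ toℕ))
        ≈⟨ x∙yz≈y∙xz _ _ _ ⟩
      -- `f 0` has rejoined the later terms of `f`, which gives `n + 2` terms, one more than
      -- `binomialSum n` has.
      binomialSum n (λ i j → G (suc i) j) + sum {suc (suc n)} (f ∘ toℕ)
        ≈⟨ +-congˡ drop-last ⟩
      binomialSum n (λ i j → G (suc i) j) + binomialSum n (λ i j → G i (suc j))
        ≈⟨ binomialSum-+ n (λ i j → G (suc i) j) (λ i j → G i (suc j)) ⟨
      binomialSum n (λ i j → G (suc i) j + G i (suc j)) ∎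
      where
      f : ℕ → Carrier
      f i = (n C i) × G i (suc n ∸ i)

      drop-last : sum {suc (suc n)} (f ∘ toℕ) ≈ binomialSum n (λ i j → G i (suc j))
      drop-last = begin
        sum {suc (suc n)} (f ∘ toℕ)
          -- The surplus term has coefficient `n C suc n`, which is zero.
          ≈⟨ sum-truncate f (ℕ.n≤1+n (suc n)) (λ t n<t → ×-congˡ (k>n⇒nCk≡0 n<t)) ⟩
        sum {suc n} (f ∘ toℕ)
          ≈⟨ sum-cong-≋ {suc n} (λ i → ×-congʳ (n C toℕ i)
               (reflexive (cong (G (toℕ i)) (ℕ.+-∸-assoc 1 (toℕ≤pred[n] i))))) ⟩
        binomialSum n (λ i j → G i (suc j)) ∎

  -- `binomialSum n G` is the `n`-th iterate of `Δ` on `G`, evaluated at the origin, so this is the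
  -- law `Δ^(m+n) = Δ^m Δ^n`. The induction peels off one `Δ` at a time.
  binomialSum-homo-+ : ∀ m n G → binomialSum (m ℕ.+ n) G ≈
    binomialSum m (λ i j → binomialSum n (λ i′ j′ → G (i ℕ.+ i′) (j ℕ.+ j′)))
  binomialSum-homo-+ zero    n G = sym (binomialSum-zero _)
  binomialSum-homo-+ (suc m) n G = begin
    binomialSum (suc m ℕ.+ n) G
      ≈⟨ binomialSum-suc (m ℕ.+ n) G ⟩
    binomialSum (m ℕ.+ n) (λ i j → G (suc i) j + G i (suc j))
      ≈⟨ binomialSum-homo-+ m n _ ⟩
    binomialSum m (λ i j → binomialSum n (λ i′ j′ →
      G (suc i ℕ.+ i′) (j ℕ.+ j′) + G (i ℕ.+ i′) (suc j ℕ.+ j′)))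
      ≈⟨ binomialSum-cong m (λ i j _ _ → binomialSum-+ n _ _) ⟩
    binomialSum m (λ i j →
      binomialSum n (λ i′ j′ → G (suc i ℕ.+ i′) (j ℕ.+ j′)) +
      binomialSum n (λ i′ j′ → G (i ℕ.+ i′) (suc j ℕ.+ j′)))
      ≈⟨ binomialSum-suc m _ ⟨
    binomialSum (suc m) (λ i j → binomialSum n (λ i′ j′ → G (i ℕ.+ i′) (j ℕ.+ j′))) ∎

  module _ {p} (p-prime : Prime p) (p×x≈0 : ∀ x → p × x ≈ 0#) where

    p∣n⇒n×x≈0 : ∀ {n} → p ∣ n → ∀ x → n × x ≈ 0#
    p∣n⇒n×x≈0 (divides d ≡.refl) x = begin
      (d ℕ.* p) × x ≈⟨ ×-assocˡ x d p ⟨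
      d × (p × x)   ≈⟨ ×-congʳ d (p×x≈0 x) ⟩
      d × 0#        ≈⟨ ×-zeroʳ d ⟩
      0#            ∎

    -- All coefficients strictly between the ends are divisible by `p` and annihilate their terms,
    -- as in `(x + y)^p = x^p + y^p`.
    binomialSum-prime : ∀ G → binomialSum p G ≈ G p 0 + G 0 p
    binomialSum-prime G = lemma p ≡.refl
      where
      -- Splitting `m` into `zero` and `suc m-1` exposes the first and the last term of the sum.
      lemma : ∀ m → m ≡ p → binomialSum m G ≈ G m 0 + G 0 m
      lemma zero ≡.refl = contradiction p-prime λ ()
      lemma m@(suc m-1) ≡.refl = begin
        binomialSum m G
          ≡⟨ binomialSum-expand m G ⟩
        sum {suc m} (λ i → (m C toℕ i) × G (toℕ i) (m ∸ toℕ i))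
          ≈⟨ +-cong (+-identityʳ _) (sum-init-last {m-1} (t ∘ toℕ)) ⟩
        G 0 m + (sum {m-1} (t ∘ toℕ ∘ inject₁) + t (toℕ (fromℕ m-1)))
          ≈⟨ +-congˡ (+-cong (sum-zero {m-1} (t ∘ toℕ ∘ inject₁) middle) last≈) ⟩
        G 0 m + (0# + G m 0)
          ≈⟨ +-congˡ (+-identityˡ _) ⟩
        G 0 m + G m 0
          ≈⟨ +-comm _ _ ⟩
        G m 0 + G 0 m ∎
        where
        -- The terms after the first, re-indexed from zero: the values `i < m-1` are exactly the
        -- inner ones, and `i = m-1` is the last.
        t : ℕ → Carrier
        t i = (m C suc i) × G (suc i) (m-1 ∸ i)

        middle : ∀ i → t (toℕ (inject₁ i)) ≈ 0#
        middle i rewrite toℕ-inject₁ i =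
          p∣n⇒n×x≈0 (p∣pCk p-prime ℕ.z<s (s≤s (toℕ<n i))) _

        last≈ : t (toℕ (fromℕ m-1)) ≈ G m 0
        last≈ rewrite toℕ-fromℕ m-1 | nCn≡1 m | ℕ.n∸n≡0 m-1 = +-identityʳ _

    -- Splitting off a block of length `p` leaves only its two end terms, so both sides obey the
    -- same Pascal recursion, on the left with step `p`.
    binomialSum-homo-*-prime : ∀ n G → binomialSum (n ℕ.* p) G ≈
                                       binomialSum n (λ i j → G (i ℕ.* p) (j ℕ.* p))
    binomialSum-homo-*-prime zero    G = trans (binomialSum-zero G) (sym (binomialSum-zero _))
    binomialSum-homo-*-prime (suc n) G = begin
      binomialSum (p ℕ.+ n ℕ.* p) G
        ≈⟨ binomialSum-homo-+ p (n ℕ.* p) G ⟩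
      binomialSum p (λ i j → binomialSum (n ℕ.* p) (λ i′ j′ → G (i ℕ.+ i′) (j ℕ.+ j′)))
        ≈⟨ binomialSum-prime _ ⟩
      binomialSum (n ℕ.* p) (λ i j → G (p ℕ.+ i) j) +
      binomialSum (n ℕ.* p) (λ i j → G i (p ℕ.+ j))
        ≈⟨ +-cong (binomialSum-homo-*-prime n _) (binomialSum-homo-*-prime n _) ⟩
      binomialSum n (λ i j → G (suc i ℕ.* p) (j ℕ.* p)) +
      binomialSum n (λ i j → G (i ℕ.* p) (suc j ℕ.* p))
        ≈⟨ binomialSum-+ n _ _ ⟨
      binomialSum n (λ i j → G (suc i ℕ.* p) (j ℕ.* p) + G (i ℕ.* p) (suc j ℕ.* p))
        ≈⟨ binomialSum-suc n _ ⟨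
      binomialSum (suc n) (λ i j → G (i ℕ.* p) (j ℕ.* p)) ∎

    binomialSum-homo-*-prime^ : ∀ l n G → binomialSum (n ℕ.* p ^ l) G ≈
      binomialSum n (λ i j → G (i ℕ.* p ^ l) (j ℕ.* p ^ l))
    binomialSum-homo-*-prime^ zero n G = begin
      binomialSum (n ℕ.* 1) G
        ≡⟨ cong (λ m → binomialSum m G) (ℕ.*-identityʳ n) ⟩
      binomialSum n G
        ≈⟨ binomialSum-cong n (λ i j _ _ → reflexive
             (≡.sym (cong₂ G (ℕ.*-identityʳ i) (ℕ.*-identityʳ j)))) ⟩
      binomialSum n (λ i j → G (i ℕ.* 1) (j ℕ.* 1)) ∎
    binomialSum-homo-*-prime^ (suc l) n G = begin
      binomialSum (n ℕ.* (p ℕ.* p ^ l)) G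
        ≡⟨ cong (λ m → binomialSum m G) (ℕ.*-assoc n p (p ^ l)) ⟨
      -- The induction hypothesis takes out `p ^ l` with `n * p` in the role of `n`; the last factor
      -- `p` follows.
      binomialSum (n ℕ.* p ℕ.* p ^ l) G
        ≈⟨ binomialSum-homo-*-prime^ l (n ℕ.* p) G ⟩
      binomialSum (n ℕ.* p) (λ i j → G (i ℕ.* p ^ l) (j ℕ.* p ^ l))
        ≈⟨ binomialSum-homo-*-prime n _ ⟩
      binomialSum n (λ i j → G (i ℕ.* p ℕ.* p ^ l) (j ℕ.* p ℕ.* p ^ l))
        ≈⟨ binomialSum-cong n (λ i j _ _ → reflexive
             (cong₂ G (ℕ.*-assoc i p (p ^ l)) (ℕ.*-assoc j p (p ^ l)))) ⟩
      binomialSum n (λ i j → G (i ℕ.* p ^ suc l) (j ℕ.* p ^ suc l)) ∎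

-- Base-q digits and the product formula for digit monomials.

module _ (q : ℕ) .{{_ : NonZero q}} where

  digit-suc : ∀ i t → digit q i (suc t) ≡ digit q (i / q) t
  digit-suc i t = cong (_% q) (≡.sym
    (m/n/o≡m/[n*o] i q (q ^ t) {{_}} {{ℕ.m^n≢0 q t}} {{ℕ.m^n≢0 q (suc t)}}))

  -- From `i ≤ t < q ^ t` the quotient `i / q ^ t` is zero.
  i≤t⇒digit≡0 : 1 < q → ∀ i t → i ≤ t → digit q i t ≡ 0
  i≤t⇒digit≡0 1<q i t i≤t = ≡.trans
    (cong (_% q) (m<n⇒m/n≡0 {{ℕ.m^n≢0 q t}} (ℕ.≤-<-trans i≤t (n<m^n t 1<q))))
    (m<n⇒m%n≡m (ℕ.<-trans ℕ.z<s 1<q))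

  module DigitMonomial {c ℓ} (R : CommutativeSemiring c ℓ) (1<q : 1 < q) where
    open CommutativeSemiring R
    open Algebra.Properties.Semiring.Exp semiring using (^-congʳ) renaming (_^_ to _^ᴿ_)
    open RawSemiringDefinitions rawSemiring using (product)
    open Algebra.Properties.Semiring.Mult semiring using (_×_; ×-comm-*)
    open Algebra.Properties.Semiring.Sum semiring using (sum; *-distribˡ-sum; sum-cong-≋)
    open Algebra.Properties.CommutativeSemigroup *-commutativeSemigroup using (interchange)
    open SetoidReasoning setoid

    -- The monomials p_{E,i} over any commutative semiring; at `polySemiring` this unfolds to
    -- `f-P e i`.
    digitMonomial : (ℕ → Carrier) → ℕ → Carrier
    digitMonomial e i = product {i} λ t → e (toℕ t) ^ᴿ digit q i (toℕ t)

    -- The lowest digit of `i` is `i % q`, and its higher digits are the digits of `i / q`, moved up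
    -- one place.
    digitMonomial-split : ∀ e i → digitMonomial e i ≈
                          e 0 ^ᴿ (i % q) * digitMonomial (e ∘ suc) (i / q)
    digitMonomial-split e zero = begin
      digitMonomial e 0
        ≈⟨ *-identityˡ _ ⟨
      e 0 ^ᴿ 0 * digitMonomial (e ∘ suc) 0
        ≡⟨ cong₂ (λ a b → e 0 ^ᴿ a * digitMonomial (e ∘ suc) b)
             (m<n⇒m%n≡m {n = q} (ℕ.<-trans ℕ.z<s 1<q)) (0/n≡0 q) ⟨
      e 0 ^ᴿ (0 % q) * digitMonomial (e ∘ suc) (0 / q) ∎
    digitMonomial-split e i@(suc i-1) = *-cong
      -- The factor at `t = 0` has exponent `i / q ^ 0 % q`, where `q ^ 0` is `1`.
      (^-congʳ (e 0) (cong (_% q) (n/1≡n i)))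
      (begin
        product {i-1} (λ t → e (suc (toℕ t)) ^ᴿ digit q i (suc (toℕ t)))
          ≈⟨ product-cong {i-1} (λ t → ^-congʳ (e (suc (toℕ t))) (digit-suc i (toℕ t))) ⟩
        product {i-1} (λ t → e (suc (toℕ t)) ^ᴿ digit q (i / q) (toℕ t))
          -- Since `1 < q`, `i / q` is at most `i-1`; the factors from position `i / q` on have
          -- exponent zero.
          ≈⟨ sum-truncate *-commutativeMonoid (λ t → e (suc t) ^ᴿ digit q (i / q) t)
               (ℕ.≤-pred (m/n<m i q 1<q))
               (λ t i/q≤t → ^-congʳ (e (suc t)) (i≤t⇒digit≡0 1<q (i / q) t i/q≤t)) ⟩
        digitMonomial (e ∘ suc) (i / q) ∎)
      where open Algebra.Properties.CommutativeMonoid.Sum *-commutativeMonoid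
              using () renaming (sum-cong-≋ to product-cong)

    -- For `r < q` there is no carry: `r` is the lowest digit and `n` holds all the others.
    digitMonomial-r+n*q : ∀ e {r} n → r < q → digitMonomial e (r ℕ.+ n ℕ.* q) ≈
                          e 0 ^ᴿ r * digitMonomial (e ∘ suc) n
    digitMonomial-r+n*q e {r} n r<q = begin
      digitMonomial e i
        ≈⟨ digitMonomial-split e i ⟩
      e 0 ^ᴿ (i % q) * digitMonomial (e ∘ suc) (i / q)
        ≡⟨ cong₂ (λ a b → e 0 ^ᴿ a * digitMonomial (e ∘ suc) b) i%q≡r i/q≡n ⟩
      e 0 ^ᴿ r * digitMonomial (e ∘ suc) n ∎
      where
      i = r ℕ.+ n ℕ.* q

      i%q≡r : i % q ≡ r
      i%q≡r = ≡.trans ([m+kn]%n≡m%n r n q) (m<n⇒m%n≡m r<q)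

      i/q≡n : i / q ≡ n
      i/q≡n = ≡.trans (+-distrib-/-∣ʳ r (n∣m*n n))
        (cong₂ ℕ._+_ (m<n⇒m/n≡0 r<q) (m*n/n≡m n q))

    B : ℕ → (ℕ → ℕ → Carrier) → Carrier
    B = binomialSum +-commutativeMonoid

    *-distribˡ-binomialSum : ∀ x n G → x * B n G ≈ B n (λ i j → x * G i j)
    *-distribˡ-binomialSum x n G = begin
      x * B n G
        ≡⟨ cong (x *_) (binomialSum-expand +-commutativeMonoid n G) ⟩
      x * sum {suc n} (λ i → (n C toℕ i) × G (toℕ i) (n ∸ toℕ i))
        ≈⟨ *-distribˡ-sum {suc n} x (λ i → (n C toℕ i) × G (toℕ i) (n ∸ toℕ i)) ⟩
      sum {suc n} (λ i → x * (n C toℕ i) × G (toℕ i) (n ∸ toℕ i))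
        ≈⟨ sum-cong-≋ {suc n} (λ i → ×-comm-* (n C toℕ i) x (G (toℕ i) (n ∸ toℕ i))) ⟩
      sum {suc n} (λ i → (n C toℕ i) × (x * G (toℕ i) (n ∸ toℕ i)))
        ≡⟨ binomialSum-expand +-commutativeMonoid n (λ i j → x * G i j) ⟨
      B n (λ i j → x * G i j) ∎

    *-distribʳ-binomialSum : ∀ x n G → B n G * x ≈ B n (λ i j → G i j * x)
    *-distribʳ-binomialSum x n G = begin
      B n G * x                ≈⟨ *-comm _ _ ⟩
      x * B n G                ≈⟨ *-distribˡ-binomialSum x n G ⟩
      B n (λ i j → x * G i j)  ≈⟨ binomialSum-cong +-commutativeMonoid n (λ _ _ _ _ → *-comm _ _) ⟩
      B n (λ i j → G i j * x)  ∎

    module _ {p l} (p-prime : Prime p) (q≡p^l : q ≡ p ^ l) (p×x≈0 : ∀ x → p × x ≈ 0#) where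

      binomialSum-homo-*-q : ∀ n G → B (n ℕ.* q) G ≈ B n (λ i j → G (i ℕ.* q) (j ℕ.* q))
      binomialSum-homo-*-q n G rewrite q≡p^l =
        binomialSum-homo-*-prime^ +-commutativeMonoid p-prime p×x≈0 l n G

      -- The sequences stay quantified in the strong induction, because the hypothesis at `n / q` is
      -- applied to the shifted ones.
      digitMonomial-binomial : ∀ n w v →
        B n (λ i j → digitMonomial w i * digitMonomial v j) ≈
        digitMonomial (λ t → w t + v t) n
      digitMonomial-binomial = <-rec _ step
        where
        step : ∀ n → (∀ {m} → m < n → ∀ w v →
                 B m (λ i j → digitMonomial w i * digitMonomial v j) ≈
                 digitMonomial (λ t → w t + v t) m) →
               ∀ w v → B n (λ i j → digitMonomial w i * digitMonomial v j) ≈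
                       digitMonomial (λ t → w t + v t) n
        step zero _ w v = trans (binomialSum-zero +-commutativeMonoid _) (*-identityˡ _)
        step n@(suc _) rec w v = begin
          B n (λ i j → digitMonomial w i * digitMonomial v j)
            ≡⟨ cong (λ k → B k (λ i j → digitMonomial w i * digitMonomial v j)) (m≡m%n+[m/n]*n n q) ⟩
          B (r ℕ.+ m ℕ.* q) (λ i j → digitMonomial w i * digitMonomial v j)
            ≈⟨ binomialSum-homo-+ +-commutativeMonoid r (m ℕ.* q) _ ⟩
          B r (λ i j → B (m ℕ.* q) (λ i′ j′ →
            digitMonomial w (i ℕ.+ i′) * digitMonomial v (j ℕ.+ j′)))
            ≈⟨ binomialSum-cong +-commutativeMonoid r (λ i j i≤r j≤r → begin
                 B (m ℕ.* q) (λ i′ j′ → digitMonomial w (i ℕ.+ i′) * digitMonomial v (j ℕ.+ j′))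
                   ≈⟨ binomialSum-homo-*-q m _ ⟩
                 B m (λ i′ j′ → digitMonomial w (i ℕ.+ i′ ℕ.* q) * digitMonomial v (j ℕ.+ j′ ℕ.* q))
                   -- The bounds `i ≤ r` and `j ≤ r` with `r < q` rule out carries; the powers of
                   -- `w 0` and `v 0` are then gathered in front, free of `i′` and `j′`.
                   ≈⟨ binomialSum-cong +-commutativeMonoid m (λ i′ j′ _ _ → trans
                        (*-cong (digitMonomial-r+n*q w i′ (ℕ.≤-<-trans i≤r r<q))
                                (digitMonomial-r+n*q v j′ (ℕ.≤-<-trans j≤r r<q)))
                        (interchange _ _ _ _)) ⟩
                 B m (λ i′ j′ → w 0 ^ᴿ i * v 0 ^ᴿ j *
                                (digitMonomial (w ∘ suc) i′ * digitMonomial (v ∘ suc) j′))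
                   ≈⟨ *-distribˡ-binomialSum _ m _ ⟨
                 w 0 ^ᴿ i * v 0 ^ᴿ j *
                 B m (λ i′ j′ → digitMonomial (w ∘ suc) i′ * digitMonomial (v ∘ suc) j′)
                   -- Here `n` is positive, hence `n / q < n`.
                   ≈⟨ *-congˡ (rec (m/n<m n q 1<q) (w ∘ suc) (v ∘ suc)) ⟩
                 w 0 ^ᴿ i * v 0 ^ᴿ j * digitMonomial (λ t → w (suc t) + v (suc t)) m ∎) ⟩
          B r (λ i j → w 0 ^ᴿ i * v 0 ^ᴿ j * digitMonomial (λ t → w (suc t) + v (suc t)) m)
            ≈⟨ *-distribʳ-binomialSum _ r _ ⟨
          B r (λ i j → w 0 ^ᴿ i * v 0 ^ᴿ j) * digitMonomial (λ t → w (suc t) + v (suc t)) m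
            ≈⟨ *-congʳ (reflexive (binomialSum-expand +-commutativeMonoid r (λ i j → w 0 ^ᴿ i * v 0 ^ᴿ j))) ⟩
          binomialExpansion r * digitMonomial (λ t → w (suc t) + v (suc t)) m
            -- The ordinary binomial theorem accounts for the lowest digit.
            ≈⟨ *-congʳ (theorem (*-comm _ _) r) ⟨
          (w 0 + v 0) ^ᴿ r * digitMonomial (λ t → w (suc t) + v (suc t)) m
            ≈⟨ digitMonomial-split (λ t → w t + v t) n ⟨
          digitMonomial (λ t → w t + v t) n ∎
          where
          open Algebra.Properties.Semiring.Binomial semiring (w 0) (v 0) using (binomialExpansion; theorem)

          r = n % q
          m = n / q

          r<q : r < q
          r<q = m%n<n n q

-- Coefficient lists form a commutative semiring.

module PolynomialProperties {c ℓ} (R : CommutativeRing c ℓ) where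
  open CommutativeRing R
  open Polynomial rawRing
  open Algebra.Properties.Semiring.Mult semiring using (_×_)

  -- Unlike f ≈ₚ g, which unfolds to a Π-type, the record determines f and g.
  infix 4 _≋_
  record _≋_ (f g : Poly) : Set ℓ where
    constructor coeffwise
    field coeff-cong : f ≈ₚ g
  open _≋_ public

  polySetoid : Setoid c ℓ
  polySetoid = record
    { Carrier = Poly
    ; _≈_     = _≋_
    ; isEquivalence = record
      { refl  = coeffwise λ _ → refl
      ; sym   = λ f≋g → coeffwise λ n → sym (coeff-cong f≋g n)
      ; trans = λ f≋g g≋h → coeffwise λ n → trans (coeff-cong f≋g n) (coeff-cong g≋h n)
      }
    }

  open Setoid polySetoid using () renaming (refl to ≋-refl; sym to ≋-sym; trans to ≋-trans)

  -- Reduces the laws of `_+ₚ_` to those of `_+_`, whatever the lengths of the lists.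
  coeff-+ : ∀ f g n → coeff (f +ₚ g) n ≈ coeff f n + coeff g n
  coeff-+ []      g       n       = sym (+-identityˡ _)
  coeff-+ (a ∷ f) []      n       = sym (+-identityʳ _)
  coeff-+ (a ∷ f) (b ∷ g) zero    = refl
  coeff-+ (a ∷ f) (b ∷ g) (suc n) = coeff-+ f g n

  coeff-scale : ∀ a f n → coeff (map (a *_) f) n ≈ a * coeff f n
  coeff-scale a []      n       = sym (zeroʳ a)
  coeff-scale a (b ∷ f) zero    = refl
  coeff-scale a (b ∷ f) (suc n) = coeff-scale a f n

  ∷-cong : ∀ {a b f g} → a ≈ b → f ≋ g → a ∷ f ≋ b ∷ g
  ∷-cong a≈b f≋g = coeffwise λ { zero → a≈b ; (suc n) → coeff-cong f≋g n }

  0∷[]≋[] : 0# ∷ [] ≋ []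
  0∷[]≋[] = coeffwise λ { zero → refl ; (suc n) → refl }

  +ₚ-cong : ∀ {f f′ g g′} → f ≋ f′ → g ≋ g′ → f +ₚ g ≋ f′ +ₚ g′
  +ₚ-cong {f} {f′} {g} {g′} f≋f′ g≋g′ = coeffwise λ n → trans (coeff-+ f g n)
    (trans (+-cong (coeff-cong f≋f′ n) (coeff-cong g≋g′ n)) (sym (coeff-+ f′ g′ n)))

  +ₚ-assoc : ∀ f g h → (f +ₚ g) +ₚ h ≋ f +ₚ (g +ₚ h)
  +ₚ-assoc f g h = coeffwise λ n → begin
    coeff ((f +ₚ g) +ₚ h) n               ≈⟨ coeff-+ (f +ₚ g) h n ⟩
    coeff (f +ₚ g) n + coeff h n          ≈⟨ +-congʳ (coeff-+ f g n) ⟩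
    coeff f n + coeff g n + coeff h n     ≈⟨ +-assoc _ _ _ ⟩
    coeff f n + (coeff g n + coeff h n)   ≈⟨ +-congˡ (coeff-+ g h n) ⟨
    coeff f n + coeff (g +ₚ h) n          ≈⟨ coeff-+ f (g +ₚ h) n ⟨
    coeff (f +ₚ (g +ₚ h)) n               ∎
    where open SetoidReasoning setoid

  +ₚ-comm : ∀ f g → f +ₚ g ≋ g +ₚ f
  +ₚ-comm f g = coeffwise λ n →
    trans (coeff-+ f g n) (trans (+-comm _ _) (sym (coeff-+ g f n)))

  +ₚ-identityʳ : ∀ f → f +ₚ [] ≋ f
  +ₚ-identityʳ f = +ₚ-comm f []

  polyAddition : CommutativeMonoid c ℓ
  polyAddition = record
    { _≈_ = _≋_
    ; _∙_ = _+ₚ_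
    ; ε   = []
    ; isCommutativeMonoid = record
      { isMonoid = record
        { isSemigroup = record
          { isMagma = record { isEquivalence = Setoid.isEquivalence polySetoid ; ∙-cong = +ₚ-cong }
          ; assoc   = +ₚ-assoc
          }
        ; identity = (λ _ → ≋-refl) , +ₚ-identityʳ
        }
      ; comm = +ₚ-comm
      }
    }

  open CommutativeMonoid polyAddition using () renaming (∙-congˡ to +ₚ-congˡ; ∙-congʳ to +ₚ-congʳ)
  open Algebra.Properties.CommutativeSemigroup (CommutativeMonoid.commutativeSemigroup polyAddition)
    using (interchange; x∙yz≈y∙xz)
  open SetoidReasoning polySetoid

  scale : Carrier → Poly → Poly
  scale a = map (a *_)

  scale-cong : ∀ a {f g} → f ≋ g → scale a f ≋ scale a g
  scale-cong a {f} {g} f≋g = coeffwise λ n → trans (coeff-scale a f n)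
    (trans (*-congˡ (coeff-cong f≋g n)) (sym (coeff-scale a g n)))

  scale-identity : ∀ f → scale 1# f ≋ f
  scale-identity f = coeffwise λ n → trans (coeff-scale 1# f n) (*-identityˡ _)

  scale-zero : ∀ f → scale 0# f ≋ []
  scale-zero f = coeffwise λ n → trans (coeff-scale 0# f n) (zeroˡ _)

  scale-assoc : ∀ a b f → scale (a * b) f ≋ scale a (scale b f)
  scale-assoc a b []      = ≋-refl
  scale-assoc a b (x ∷ f) = ∷-cong (*-assoc a b x) (scale-assoc a b f)

  scale-+ₚ : ∀ a f g → scale a (f +ₚ g) ≋ scale a f +ₚ scale a g
  scale-+ₚ a []      g       = ≋-refl
  scale-+ₚ a (x ∷ f) []      = ≋-refl
  scale-+ₚ a (x ∷ f) (y ∷ g) = ∷-cong (distribˡ a x y) (scale-+ₚ a f g)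

  shift-+ₚ : ∀ f g → 0# ∷ (f +ₚ g) ≋ (0# ∷ f) +ₚ (0# ∷ g)
  shift-+ₚ f g = ∷-cong (sym (+-identityˡ 0#)) ≋-refl

  *ₚ-congˡ : ∀ f {g h} → g ≋ h → f *ₚ g ≋ f *ₚ h
  *ₚ-congˡ []      g≋h = ≋-refl
  *ₚ-congˡ (a ∷ f) g≋h = +ₚ-cong (scale-cong a g≋h) (∷-cong refl (*ₚ-congˡ f g≋h))

  *ₚ-zeroʳ : ∀ f → f *ₚ [] ≋ []
  *ₚ-zeroʳ []      = ≋-refl
  *ₚ-zeroʳ (a ∷ f) = ≋-trans (∷-cong refl (*ₚ-zeroʳ f)) 0∷[]≋[]

  -- The mirror image, in the second factor, of the recursion that defines `_*ₚ_`; commutativity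
  -- follows from it by induction.
  *ₚ-∷ : ∀ f b g → f *ₚ (b ∷ g) ≋ scale b f +ₚ (0# ∷ f *ₚ g)
  *ₚ-∷ []      b g = ≋-sym 0∷[]≋[]
  *ₚ-∷ (a ∷ f) b g = ∷-cong (+-congʳ (*-comm a b)) (begin
    scale a g +ₚ f *ₚ (b ∷ g)                 ≈⟨ +ₚ-congˡ (*ₚ-∷ f b g) ⟩
    scale a g +ₚ (scale b f +ₚ (0# ∷ f *ₚ g)) ≈⟨ x∙yz≈y∙xz (scale a g) (scale b f) _ ⟩
    scale b f +ₚ (scale a g +ₚ (0# ∷ f *ₚ g)) ∎)

  *ₚ-comm : ∀ f g → f *ₚ g ≋ g *ₚ f
  *ₚ-comm []      g = ≋-sym (*ₚ-zeroʳ g)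
  *ₚ-comm (a ∷ f) g = begin
    scale a g +ₚ (0# ∷ f *ₚ g) ≈⟨ +ₚ-congˡ (∷-cong refl (*ₚ-comm f g)) ⟩
    scale a g +ₚ (0# ∷ g *ₚ f) ≈⟨ *ₚ-∷ g a f ⟨
    g *ₚ (a ∷ f)               ∎

  -- Equal polynomials may be lists of different lengths, so congruence in the left factor is
  -- reduced by commutativity to the right factor.
  *ₚ-cong : ∀ {f f′ g g′} → f ≋ f′ → g ≋ g′ → f *ₚ g ≋ f′ *ₚ g′
  *ₚ-cong {f} {f′} {g} {g′} f≋f′ g≋g′ = begin
    f *ₚ g   ≈⟨ *ₚ-congˡ f g≋g′ ⟩
    f *ₚ g′  ≈⟨ *ₚ-comm f g′ ⟩
    g′ *ₚ f  ≈⟨ *ₚ-congˡ g′ f≋f′ ⟩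
    g′ *ₚ f′ ≈⟨ *ₚ-comm g′ f′ ⟩
    f′ *ₚ g′ ∎

  *ₚ-distribˡ : ∀ f g h → f *ₚ (g +ₚ h) ≋ f *ₚ g +ₚ f *ₚ h
  *ₚ-distribˡ []      g h = ≋-refl
  *ₚ-distribˡ (a ∷ f) g h = begin
    scale a (g +ₚ h) +ₚ (0# ∷ f *ₚ (g +ₚ h))
      ≈⟨ +ₚ-cong (scale-+ₚ a g h) (∷-cong refl (*ₚ-distribˡ f g h)) ⟩
    (scale a g +ₚ scale a h) +ₚ (0# ∷ (f *ₚ g +ₚ f *ₚ h))
      ≈⟨ +ₚ-congˡ (shift-+ₚ (f *ₚ g) (f *ₚ h)) ⟩
    (scale a g +ₚ scale a h) +ₚ ((0# ∷ f *ₚ g) +ₚ (0# ∷ f *ₚ h))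
      ≈⟨ interchange (scale a g) (scale a h) _ _ ⟩
    (scale a g +ₚ (0# ∷ f *ₚ g)) +ₚ (scale a h +ₚ (0# ∷ f *ₚ h)) ∎

  *ₚ-distribʳ : ∀ f g h → (g +ₚ h) *ₚ f ≋ g *ₚ f +ₚ h *ₚ f
  *ₚ-distribʳ f g h = begin
    (g +ₚ h) *ₚ f    ≈⟨ *ₚ-comm (g +ₚ h) f ⟩
    f *ₚ (g +ₚ h)    ≈⟨ *ₚ-distribˡ f g h ⟩
    f *ₚ g +ₚ f *ₚ h ≈⟨ +ₚ-cong (*ₚ-comm f g) (*ₚ-comm f h) ⟩
    g *ₚ f +ₚ h *ₚ f ∎

  scale-*ₚ : ∀ a f g → scale a f *ₚ g ≋ scale a (f *ₚ g)
  scale-*ₚ a []      g = ≋-refl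
  scale-*ₚ a (b ∷ f) g = begin
    scale (a * b) g +ₚ (0# ∷ scale a f *ₚ g)
      ≈⟨ +ₚ-cong (scale-assoc a b g) (∷-cong (sym (zeroʳ a)) (scale-*ₚ a f g)) ⟩
    scale a (scale b g) +ₚ scale a (0# ∷ f *ₚ g)
      ≈⟨ scale-+ₚ a (scale b g) (0# ∷ f *ₚ g) ⟨
    scale a (scale b g +ₚ (0# ∷ f *ₚ g)) ∎

  *ₚ-assoc : ∀ f g h → (f *ₚ g) *ₚ h ≋ f *ₚ (g *ₚ h)
  *ₚ-assoc []      g h = ≋-refl
  *ₚ-assoc (a ∷ f) g h = begin
    (scale a g +ₚ (0# ∷ f *ₚ g)) *ₚ h
      ≈⟨ *ₚ-distribʳ h (scale a g) _ ⟩
    -- The head of the shifted list `0# ∷ f *ₚ g` contributes `scale 0# h`, which vanishes.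
    scale a g *ₚ h +ₚ (scale 0# h +ₚ (0# ∷ (f *ₚ g) *ₚ h))
      ≈⟨ +ₚ-cong (scale-*ₚ a g h) (+ₚ-cong (scale-zero h) (∷-cong refl (*ₚ-assoc f g h))) ⟩
    scale a (g *ₚ h) +ₚ (0# ∷ f *ₚ (g *ₚ h)) ∎

  *ₚ-identityˡ : ∀ f → const 1# *ₚ f ≋ f
  *ₚ-identityˡ f = begin
    scale 1# f +ₚ (0# ∷ []) ≈⟨ +ₚ-cong (scale-identity f) 0∷[]≋[] ⟩
    f +ₚ []                 ≈⟨ +ₚ-identityʳ f ⟩
    f                       ∎

  -- Stated for _≈ₚ_ itself: n × f and f ^ n, being stuck on n, are only equal
  -- to those of polyRing if the two raw structures agree in every field.
  polySemiring : CommutativeSemiring c ℓ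
  polySemiring = record
    { _≈_ = _≈ₚ_
    ; _+_ = _+ₚ_
    ; _*_ = _*ₚ_
    ; 0#  = []
    ; 1#  = const 1#
    ; isCommutativeSemiring = record
      { isSemiring = record
        { isSemiringWithoutAnnihilatingZero = record
          { +-isCommutativeMonoid = record
            { isMonoid = record
              { isSemigroup = record
                { isMagma = record
                  { isEquivalence = record
                    { refl  = λ _ → refl
                    ; sym   = λ f≈g n → sym (f≈g n)
                    ; trans = λ f≈g g≈h n → trans (f≈g n) (g≈h n)
                    }
                  ; ∙-cong = λ {f} {f′} {g} {g′} f≈f′ g≈g′ →
                      coeff-cong (+ₚ-cong {f} {f′} {g} {g′} (coeffwise f≈f′) (coeffwise g≈g′))
                  }
                ; assoc = λ f g h → coeff-cong (+ₚ-assoc f g h)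
                }
              ; identity = (λ _ _ → refl) , λ f → coeff-cong (+ₚ-identityʳ f)
              }
            ; comm = λ f g → coeff-cong (+ₚ-comm f g)
            }
          ; *-cong     = λ {f} {f′} {g} {g′} f≈f′ g≈g′ →
            coeff-cong (*ₚ-cong {f} {f′} {g} {g′} (coeffwise f≈f′) (coeffwise g≈g′))
          ; *-assoc    = λ f g h → coeff-cong (*ₚ-assoc f g h)
          ; *-identity = (λ f → coeff-cong (*ₚ-identityˡ f)) ,
                         λ f → coeff-cong (≋-trans (*ₚ-comm f _) (*ₚ-identityˡ f))
          ; distrib    = (λ f g h → coeff-cong (*ₚ-distribˡ f g h)) ,
                         λ f g h → coeff-cong (*ₚ-distribʳ f g h)
          }
        ; zero = (λ _ _ → refl) , λ f → coeff-cong (*ₚ-zeroʳ f)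
        }
      ; *-comm = λ f g → coeff-cong (*ₚ-comm f g)
      }
    }

  open Algebra.Properties.Semiring.Mult (CommutativeSemiring.semiring polySemiring)
    using () renaming (_×_ to _×ₚ_)

  -- Carries the vanishing of `p × x` from the coefficients to polynomials.
  coeff-× : ∀ n f k → coeff (n ×ₚ f) k ≈ n × coeff f k
  coeff-× zero    f k = refl
  coeff-× (suc n) f k = trans (coeff-+ f (n ×ₚ f) k) (+-congˡ (coeff-× n f k))

-- The characteristic of F: nilpotents in a Heyting field and orders in a finite abelian group.

module _ {c ℓ₁ ℓ₂} (F : HeytingField c ℓ₁ ℓ₂) where
  open HeytingField F
  open HeytingProperties heytingCommutativeRing
  open CommutativeRing (fieldCommutativeRing F) using (semiring)
  open Algebra.Properties.Semiring.Exp semiring renaming (_^_ to _^ᶠ_)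
  open Algebra.Properties.Semiring.Mult semiring

  x#0⇒x^n#0 : ∀ {x} n → x # 0# → x ^ᶠ n # 0#
  x#0⇒x^n#0 zero    x#0 = 1#0
  x#0⇒x^n#0 (suc n) x#0 = x#0y#0→xy#0 x#0 (x#0⇒x^n#0 n x#0)

  -- Apartness is tight, so it suffices to refute `x # 0#`, which would make the power apart from
  -- zero as well. Decidable equality is not assumed.
  x^n≈0⇒x≈0 : ∀ {x} n → x ^ᶠ n ≈ 0# → x ≈ 0#
  x^n≈0⇒x≈0 n x^n≈0 = proj₁ (tight _ _) λ x#0 →
    #-irrefl refl (#-congʳ x^n≈0 (x#0⇒x^n#0 n x#0))

  -- Turns `q × 1# ≈ 0#` into nilpotency of `p × 1#`.
  ×1-homo-^ : ∀ m n → (m ^ n) × 1# ≈ (m × 1#) ^ᶠ n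
  ×1-homo-^ m zero    = +-identityʳ 1#
  ×1-homo-^ m (suc n) = trans (×1-homo-* m (m ^ n)) (*-congˡ (×1-homo-^ m n))

-- Translation by x permutes the group, so ∑ y = ∑ (x + y) = |G| x + ∑ y.
module _ {c ℓ} (G : AbelianGroup c ℓ) {n}
         (elements : Inverse (≡.setoid (Fin n)) (AbelianGroup.setoid G)) where
  open AbelianGroup G
  open Inverse elements using (to; from; from-cong; strictlyInverseˡ; strictlyInverseʳ)
  open Algebra.Properties.Group group using (identityˡ-unique)
  open Algebra.Properties.CommutativeMonoid.Mult commutativeMonoid using (_×_)
  open Algebra.Properties.CommutativeMonoid.Sum commutativeMonoid
  open SetoidReasoning setoid

  translation : Carrier → Permutation′ n
  translation x = permutation (λ i → from (x ∙ to i)) (λ i → from (x ⁻¹ ∙ to i))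
    (λ i → translate-back (inverseʳ x) i) (λ i → translate-back (inverseˡ x) i)
    where
    translate-back : ∀ {x y} → x ∙ y ≈ ε → ∀ i → from (x ∙ to (from (y ∙ to i))) ≡ i
    translate-back {x} {y} xy≈ε i = ≡.trans
      (from-cong (begin
        x ∙ to (from (y ∙ to i)) ≈⟨ ∙-congˡ (strictlyInverseˡ _) ⟩
        x ∙ (y ∙ to i)           ≈⟨ assoc x y _ ⟨
        (x ∙ y) ∙ to i           ≈⟨ ∙-congʳ xy≈ε ⟩
        ε ∙ to i                 ≈⟨ identityˡ _ ⟩
        to i                     ∎))
      (strictlyInverseʳ i)

  order×x≈ε : ∀ x → n × x ≈ ε
  -- `n × x` leaves `sum to` fixed, so by cancellation it is the identity.
  order×x≈ε x = identityˡ-unique _ (sum to) (sym (begin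
    sum to                                      ≈⟨ sum-permute to (translation x) ⟩
    sum (λ i → to (translation x ⟨$⟩ʳ i))        ≈⟨ sum-cong-≋ (λ i → strictlyInverseˡ (x ∙ to i)) ⟩
    sum (λ i → x ∙ to i)                        ≈⟨ ∑-distrib-+ (λ _ → x) to ⟩
    sum {n} (λ _ → x) ∙ sum to                  ≈⟨ ∙-congʳ (sum-replicate n) ⟩
    (n × x) ∙ sum to                            ∎))

module _ {c ℓ₁ ℓ₂ k κ₁ κ₂ q} {F : HeytingField c ℓ₁ ℓ₂} (S : FiniteSubfield q F k κ₁ κ₂) where
  open FiniteSubfield S
  open HeytingField F
  open IsRingMonomorphism embed-isRingMonomorphism using (⟦⟧-cong; +-homo; 0#-homo; 1#-homo)
  private
    module K = CommutativeRing (fieldCommutativeRing 𝔽q)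
  open Algebra.Properties.Semiring.Mult K.semiring using () renaming (_×_ to _×ᴷ_)
  open CommutativeRing (fieldCommutativeRing F) using (semiring)
  open Algebra.Properties.Semiring.Mult semiring using (_×_; ×-assoc-*; ×-congʳ)
  open SetoidReasoning setoid

  embed-× : ∀ n x → embed (n ×ᴷ x) ≈ n × embed x
  embed-× zero    x = 0#-homo
  embed-× (suc n) x = trans (+-homo x _) (+-congˡ (embed-× n x))

  -- The additive group of `𝔽q` has `q` elements, so `q` annihilates its unit, and `embed`
  -- transports this to the larger field.
  q×1≈0 : q × 1# ≈ 0#
  q×1≈0 = begin
    q × 1#             ≈⟨ ×-congʳ q 1#-homo ⟨
    q × embed K.1#     ≈⟨ embed-× q K.1# ⟨
    embed (q ×ᴷ K.1#)  ≈⟨ ⟦⟧-cong (order×x≈ε K.+-abelianGroup elements K.1#) ⟩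
    embed K.0#         ≈⟨ 0#-homo ⟩
    0#                 ∎

  -- `p × 1#` is nilpotent and hence zero, and `p × x` is its multiple by `x`.
  characteristic : ∀ {p} l → q ≡ p ^ l → ∀ x → p × x ≈ 0#
  characteristic {p} l ≡.refl x = begin
    p × x         ≈⟨ ×-congʳ p (*-identityˡ x) ⟨
    p × (1# * x)  ≈⟨ ×-assoc-* p 1# x ⟨
    (p × 1#) * x  ≈⟨ *-congʳ (x^n≈0⇒x≈0 F l (trans (sym (×1-homo-^ F p l)) q×1≈0)) ⟩
    0# * x        ≈⟨ zeroˡ x ⟩
    0#            ∎

-- The product formula over F[x], coefficient by coefficient.

theorem3 : ∀ {c ℓ₁ ℓ₂ k κ₁ κ₂}
    (p l q : ℕ) .{{_ : NonZero q}} → Prime p → l ≥ 1 → q ≡ p ^ l →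
    (F : HeytingField c ℓ₁ ℓ₂) → FiniteSubfield q F k κ₁ κ₂ →
    let open LinearPolynomials q F in
    (W V : ℕ → Poly) → (∀ t → IsFqLinear (W t)) → (∀ t → IsFqLinear (V t)) →
    f-P W *ₛ f-P V ≈ₛ f-P (W ⊕ V)
theorem3 p l q p-prime l≥1 q≡p^l F S W V _ _ n = begin
  (f-P W *ₛ f-P V) n
    -- The product of divided series has this binomial sum as its `n`-th coefficient by definition.
    ≡⟨ binomialSum-expand +-commutativeMonoid n (λ i j → f-P W i *ₚ f-P V j) ⟨
  B n (λ i j → f-P W i *ₚ f-P V j)
    ≈⟨ digitMonomial-binomial {p} {l} p-prime q≡p^l p×f≈0 n W V ⟩
  f-P (W ⊕ V) n ∎
  where
  open LinearPolynomials q F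
  open PolynomialProperties (fieldCommutativeRing F) using (polySemiring; coeff-×)
  open CommutativeSemiring polySemiring using (setoid; semiring; +-commutativeMonoid)
  open Algebra.Properties.Semiring.Mult semiring using (_×_)
  open SetoidReasoning setoid

  1<q : 1 < q
  -- `1 < p = p ^ 1 ≤ p ^ l`, where the last inequality rests on `l ≥ 1`.
  1<q rewrite q≡p^l = ℕ.<-≤-trans (ℕ.nonTrivial⇒n>1 p)
    (≡.subst (ℕ._≤ p ^ l) (ℕ.*-identityʳ p) (ℕ.^-monoʳ-≤ p l≥1))
    where instance
      _ = prime⇒nonTrivial p-prime
      _ = ℕ.nonTrivial⇒nonZero p

  open DigitMonomial q polySemiring 1<q using (B; digitMonomial-binomial)

  p×f≈0 : ∀ f → p × f ≈ₚ []
  p×f≈0 f k = HeytingField.trans F (coeff-× p f k) (characteristic S l q≡p^l _)
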